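{- Let $F=F_{[a_1,b_1]}\cdots F_{[a_m,b_m]}$ be a star network of order $n$ with interior vertices $x_1,\dots,x_m$. If for some $v\in\mathfrak S_n$ and $d\ge1$ the set $\Pi_{v,d}(F)$ is nonempty, then the sets $\Pi_{v,0}(F),\dots,\Pi_{v,d-1}(F)$ are also nonempty.
   Context: A planar network of order $n$ is a directed, planar, acyclic multigraph embedded in the plane with $n$ source vertices on the left and $n$ sink vertices on the right, each labeled $1,\dots,n$ from bottom to top; edges may carry a positive integer multiplicity. For an interval $[a,b]\subseteq[n]$ (possibly empty), the simple star network $F_{[a,b]}$ has one interior vertex $x$, edges source $i\to x$ and $x\to$ sink $i$ for $i\in[a,b]$, and an edge source $i\to$ sink $i$ for $i\notin[a,b]$. The concatenation $E\circ F$ is obtained by deleting sink $i$ of $E$ and source $i$ of $F$ for each $i$ and merging each edge of $E$ ending at sink $i$ with each edge of $F$ starting at source $i$ into one edge. The condensed concatenation $E\bullet F$ is obtained from $E\circ F$ by replacing, for each pair of interior vertices joined by $p>1$ parallel edges, these edges by a single edge of multiplicity $p$. A star network $F=F_{[a_1,b_1]}\cdots F_{[a_m,b_m]}$ is any network built from $F_{[a_1,b_1]},\dots,F_{[a_m,b_m]}$ (in this order) by any combination of concatenations and condensed concatenations; its interior vertices are $x_1,\dots,x_m$, $x_j$ coming from $F_{[a_j,b_j]}$. A path family of type $v\in\mathfrak S_n$ is a sequence $\pi=(\pi_1,\dots,\pi_n)$ of source-to-sink paths with $\pi_i$ from source $i$ to sink $v_i$; it covers $F$ if each edge of multiplicity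 $p$ lies on exactly $p$ of the paths. $\Pi(F)$ is the set of covering path families, $\Pi_v(F)$ those of type $v$. The intersection of two paths has components that are single vertices or paths $(x_k,\dots,x_\ell)$; the two paths meet at the initial vertex $x_k$ of each component, and the component is a crossing if the paths enter $x_k$ and exit $x_\ell$ in different vertical orders (in the planar embedding). A defect of $\pi\in\Pi(F)$ at $x_k$ is a triple $(\pi_i,\pi_j,k)$ with $i<j$ such that $\pi_i,\pi_j$ meet at $x_k$ after having crossed an odd number of times; $\mathrm{dfct}(\pi)$ is the number of defects and $\Pi_{v,d}(F)=\{\pi\in\Pi_v(F):\mathrm{dfct}(\pi)=d\}$. -}

module Defs where

open import Data.Nat using (ℕ; zero; suc; _+_; _<ᵇ_; _≡ᵇ_)
open import Data.Nat.Base using (_≤ᵇ_)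
open import Data.Bool using (Bool; true; false; _∧_; _∨_; not; if_then_else_; T)
open import Data.Fin using (Fin; toℕ; splitAt)
open import Data.List using (List; []; _∷_; map)
open import Data.Nat.ListAction using (sum)
open import Data.Maybe using (Maybe; just; nothing)
open import Data.Product using (Σ; _×_; _,_)
open import Data.Sum using (inj₁; inj₂)
open import Data.Fin.Permutation using (Permutation′; _⟨$⟩ʳ_)
open import Relation.Binary.PropositionalEquality using (_≡_)
open import Data.List using () renaming (allFin to allFinL)

allFin : (k : ℕ) → List (Fin k)
allFin k = allFinL k

count : {A : Set} → (A → Bool) → List A → ℕ
count p []       = 0
count p (x ∷ xs) = if p x then suc (count p xs) else count p xs

findFirst : {A : Set} → (A → Bool) → List A → Maybe A
findFirst p []       = nothing
findFirst p (x ∷ xs) = if p x then just x else findFirst p xs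

oddᵇ : ℕ → Bool
oddᵇ zero    = false
oddᵇ (suc k) = not (oddᵇ k)

_==F_ : {k : ℕ} → Fin k → Fin k → Bool
i ==F j = toℕ i ≡ᵇ toℕ j

_<F_ : {k : ℕ} → Fin k → Fin k → Bool
i <F j = toℕ i <ᵇ toℕ j

-- Intervals [a,b] ⊆ [n] (possibly empty).  Fin n encodes 1..n as 0..n-1.

Interval : ℕ → Set
Interval n = Maybe (Fin n × Fin n)

_∈I_ : {n : ℕ} → Fin n → Interval n → Bool
i ∈I nothing      = false
i ∈I just (a , b) = (toℕ a ≤ᵇ toℕ i) ∧ (toℕ i ≤ᵇ toℕ b)

-- The bracketing of a star network F_{[a_1,b_1]} ⋯ F_{[a_m,b_m]}:
-- a binary tree with m leaves (the simple star networks, in order);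
-- each internal node is a concatenation (false, E ∘ F) or a
-- condensed concatenation (true, E • F).

data Shape : ℕ → Set where
  leaf : Shape 1
  node : {m k : ℕ} → Bool → Shape m → Shape k → Shape (m + k)

-- condensed S j k = true iff the parallel edges between x_j and x_k
-- (which are created at the least common ancestor node of leaves j,k)
-- get condensed, i.e. some node on the way from that ancestor to the
-- root (inclusive) is a condensed concatenation.
condensed : {m : ℕ} → Shape m → Fin m → Fin m → Bool
condensed leaf j k = false
condensed (node {m} {k'} true  L R) j k = true
condensed (node {m} {k'} false L R) j k with splitAt m j | splitAt m k
... | inj₁ j₁ | inj₁ k₁ = condensed L j₁ k₁
... | inj₂ j₂ | inj₂ k₂ = condensed R j₂ k₂
... | _       | _       = false

data Vertex (n m : ℕ) : Set where
  src : Fin n → Vertex n m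
  int : Fin m → Vertex n m
  snk : Fin n → Vertex n m

module Net {n m : ℕ} (I : Fin m → Interval n) (S : Shape m) where

  _==V_ : Vertex n m → Vertex n m → Bool
  src i ==V src j = i ==F j
  int i ==V int j = i ==F j
  snk i ==V snk j = i ==F j
  _     ==V _     = false

  -- (uncondensed) edges are "wire segments": the edge leaving vertex u
  -- along wire (level) i.  rawExit u i: such an edge exists.
  rawExit : Vertex n m → Fin n → Bool
  rawExit (src s) i = s ==F i
  rawExit (int j) i = i ∈I I j
  rawExit (snk t) i = false

  nextV : Vertex n m → Fin n → Vertex n m
  nextV (src s) i with findFirst (λ k → i ∈I I k) (allFin m)
  ... | just k  = int k
  ... | nothing = snk i
  nextV (int j) i with findFirst (λ k → (j <F k) ∧ (i ∈I I k)) (allFin m)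
  ... | just k  = int k
  ... | nothing = snk i
  nextV (snk t) i = snk t

  -- wire-edges (u,i) and (u,i') are the same edge of the (condensed)
  -- network: same wire, or parallel edges x_j → x_k that were condensed.
  sameClass : Vertex n m → Fin n → Fin n → Bool
  sameClass (int j) i i' with nextV (int j) i | nextV (int j) i'
  ... | int k | int k' = (i ==F i') ∨ ((k ==F k') ∧ condensed S j k)
  ... | _     | _      = i ==F i'
  sameClass u i i' = i ==F i'

  -- canonical wire of an edge: the lowest wire among the edges merged
  -- into it (this is also its vertical position in the embedding)
  rep : Vertex n m → Fin n → Fin n
  rep u i with findFirst (λ i' → rawExit u i' ∧ sameClass u i i') (allFin n)
  ... | just i' = i'
  ... | nothing = i

  isEdge : Vertex n m → Fin n → Bool
  isEdge u i = rawExit u i ∧ (rep u i ==F i)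

  mult : Vertex n m → Fin n → ℕ
  mult u i = count (λ i' → rawExit u i' ∧ sameClass u i i') (allFin n)

  Valid : Vertex n m → List (Fin n) → Vertex n m → Set
  Valid u []       z = u ≡ z
  Valid u (i ∷ ws) z = T (isEdge u i) × Valid (nextV u i) ws z

  record Path (s t : Fin n) : Set where
    constructor path
    field
      ws : List (Fin n)
      ok : Valid (src s) ws (snk t)

  steps : Vertex n m → List (Fin n) → List (Vertex n m × Fin n)
  steps u []       = []
  steps u (i ∷ ws) = (u , i) ∷ steps (nextV u i) ws

  edgesOf : {s t : Fin n} → Path s t → List (Vertex n m × Fin n)
  edgesOf {s} p = steps (src s) (Path.ws p)

  usesEdge : {s t : Fin n} → Path s t → Vertex n m → Fin n → Bool
  usesEdge p u i = count (λ e → (Data.Product.proj₁ e ==V u) ∧ (Data.Product.proj₂ e ==F i)) (edgesOf p) ≡ᵇ 1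
    where import Data.Product

  inE : {s t : Fin n} → Path s t → Fin m → Maybe (Vertex n m × Fin n)
  inE p k = findFirst (λ e → nextV (Data.Product.proj₁ e) (Data.Product.proj₂ e) ==V int k) (edgesOf p)
    where import Data.Product

  outW : {s t : Fin n} → Path s t → Fin m → Maybe (Fin n)
  outW p k with findFirst (λ e → Data.Product.proj₁ e ==V int k) (edgesOf p)
    where import Data.Product
  ... | just (_ , i) = just i
  ... | nothing      = nothing

  module _ {s t s' t' : Fin n} (p : Path s t) (q : Path s' t') where

    -- p and q meet at x_k: both pass through x_k, entering it by
    -- different edges (x_k is the initial vertex of a component of the
    -- intersection of p and q)
    meet : Fin m → Bool
    meet k with inE p k | inE q k
    ... | just (u , i) | just (u' , i') = not ((u ==V u') ∧ (i ==F i'))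
    ... | _            | _              = false

    enterBelow : Fin m → Bool
    enterBelow k with inE p k | inE q k
    ... | just (_ , i) | just (_ , i') = i <F i'
    ... | _            | _             = false

    -- following the common edges from x_k to the last vertex x_ℓ of the
    -- component, does p leave x_ℓ below q?  (fuel bounds the length)
    exitBelowF : ℕ → Fin m → Maybe Bool
    continue : ℕ → Vertex n m → Maybe Bool
    continue f (int k') = exitBelowF f k'
    continue f _        = nothing
    exitBelowF zero    k = nothing
    exitBelowF (suc f) k with outW p k | outW q k
    ... | just i | just i' =
          if i ==F i'
          then continue f (nextV (int k) i)
          else just (i <F i')
    ... | _      | _       = nothing

    crossingAt : Fin m → Bool
    crossingAt k with exitBelowF (suc m) k
    ... | just b  = meet k ∧ not (b ==B enterBelow k)
      where
        _==B_ : Bool → Bool → Bool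
        true  ==B y = y
        false ==B y = not y
    ... | nothing = false

    crossingsBefore : Fin m → ℕ
    crossingsBefore k = count (λ k' → (k' <F k) ∧ crossingAt k') (allFin m)

    defectAt : Fin m → Bool
    defectAt k = meet k ∧ oddᵇ (crossingsBefore k)

  PathFamily : Permutation′ n → Set
  PathFamily v = (i : Fin n) → Path i (v ⟨$⟩ʳ i)

  Covers : {v : Permutation′ n} → PathFamily v → Set
  Covers π = (u : Vertex n m) (i : Fin n) → T (isEdge u i) →
             count (λ a → usesEdge (π a) u i) (allFin n) ≡ mult u i

  dfct : {v : Permutation′ n} → PathFamily v → ℕ
  dfct π = sum (map (λ a → sum (map (λ b →
             count (λ k → (a <F b) ∧ defectAt (π a) (π b) k) (allFin m))
           (allFin n))) (allFin n))

  PiVD : Permutation′ n → ℕ → Set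
  PiVD v d = Σ (PathFamily v) (λ π → Covers {v} π × (dfct {v} π ≡ d))

{-# OPTIONS --safe #-}
-- Record each path as its trajectory, the wire it uses just before each
-- vertex.  For two paths with sources i < j, the parity of their crossings is
-- the order of their current wires, so a defect at x_k is a pair i < j entering
-- x_k in inverted order.  Take the first vertex x_k with a defect, a defective
-- pair (i, j) there such that no path through x_k has its index strictly
-- between i and j, and the last vertex x_l before x_k that both paths visit.
-- Exchanging the two paths between x_l and x_k removes exactly one defect at
-- x_k, and can only create defects between x_l and x_k, where there were none;
-- so the number of defects drops by at most one.  The sum of
-- (n - i) * wire over all paths and times strictly decreases, so iterating
-- reaches a family without defects and cannot skip a value on the way.
module Submission where

open import Defs
import Data.Bool as Bool
open import Data.Bool using (Bool; true; false; _∧_; not; if_then_else_; T; _xor_)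
open import Data.Bool.Properties using (T-≡; T-∧; ∧-zeroʳ; ∧-comm; ∧-assoc; ¬-not)
open import Data.Empty using (⊥; ⊥-elim)
import Data.Fin as Fin
open import Data.Fin using (Fin; zero; suc; toℕ; fromℕ<)
open import Data.Fin.Permutation using (Permutation′; _⟨$⟩ʳ_; transpose) renaming (id to idₚ)
open import Data.Fin.Properties
  using (toℕ-injective; toℕ-inject; toℕ<n; toℕ-fromℕ<; any?; ¬∀⟶∃¬-smallest)
import Data.List as List
open import Data.List using (List; []; _∷_; tabulate)
open import Data.Maybe using (just; nothing)
open import Data.Nat using (ℕ; zero; suc; _+_; _*_; _∸_; _≤_; _<_; z≤n; s≤s; _≤ᵇ_; _<ᵇ_)
open import Data.Nat.Induction using (<-wellFounded)
import Data.Nat.ListAction as ListAction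
open import Data.Nat.Properties
open import Algebra.Properties.CommutativeMonoid.Sum +-0-commutativeMonoid
  using (sum; sum-cong-≗; ∑-distrib-+; ∑-comm; sum-permute; sum-replicate-zero)
open import Data.Nat.Solver using (module +-*-Solver)
open import Data.Product using (∃; _×_; _,_; proj₁; proj₂)
open import Data.Sum using (_⊎_; inj₁; inj₂)
open import Function using (_∘_)
open import Function.Bundles using (Equivalence)
open import Induction.WellFounded using (Acc; acc)
open import Relation.Binary using (tri<; tri≈; tri>)
open import Relation.Binary.PropositionalEquality
open import Relation.Nullary using (¬_; Dec; yes; no; contradiction; _×-dec_)

-- Booleans, order on `Fin`, and list search

T⇒≡ : ∀ {b} → T b → b ≡ true
T⇒≡ = Equivalence.to T-≡

≡⇒T : ∀ {b} → b ≡ true → T b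
≡⇒T = Equivalence.from T-≡

¬T⇒≡ : ∀ {b} → ¬ T b → b ≡ false
¬T⇒≡ ¬b = ¬-not (¬b ∘ ≡⇒T)

true≢false : ∀ {b} → b ≡ true → b ≡ false → ∀ {A : Set} → A
true≢false {true} _ ()

if-true : ∀ {A : Set} {b} {x y : A} → b ≡ true → (if b then x else y) ≡ x
if-true refl = refl

bool? : ∀ b → (b ≡ true) ⊎ (b ≡ false)
bool? true  = inj₁ refl
bool? false = inj₂ refl

module _ {k : ℕ} {i j : Fin k} where

  <F-true : toℕ i < toℕ j → (i <F j) ≡ true
  <F-true = T⇒≡ ∘ <⇒<ᵇ

  <F-false : ¬ toℕ i < toℕ j → (i <F j) ≡ false
  <F-false i≮j = ¬T⇒≡ (i≮j ∘ <ᵇ⇒< _ _)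

  <F⇒< : (i <F j) ≡ true → toℕ i < toℕ j
  <F⇒< = <ᵇ⇒< _ _ ∘ ≡⇒T

  ==F-true : i ≡ j → (i ==F j) ≡ true
  ==F-true = T⇒≡ ∘ ≡⇒≡ᵇ _ _ ∘ cong toℕ

  ==F-false : i ≢ j → (i ==F j) ≡ false
  ==F-false i≢j = ¬T⇒≡ (i≢j ∘ toℕ-injective ∘ ≡ᵇ⇒≡ _ _)

  ==F⇒≡ : (i ==F j) ≡ true → i ≡ j
  ==F⇒≡ = toℕ-injective ∘ ≡ᵇ⇒≡ _ _ ∘ ≡⇒T

  ==F⇒≢ : (i ==F j) ≡ false → i ≢ j
  ==F⇒≢ i≠j i≡j = true≢false (==F-true i≡j) i≠j

  <F-flip : i ≢ j → not (i <F j) ≡ (j <F i)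
  <F-flip i≢j with <-cmp (toℕ i) (toℕ j)
  ... | tri< lt _ _ rewrite <F-true lt = sym (¬T⇒≡ (<⇒≯ lt ∘ <ᵇ⇒< (toℕ j) (toℕ i)))
  ... | tri≈ _ eq _ = contradiction (toℕ-injective eq) i≢j
  ... | tri> _ _ gt rewrite <F-false (<⇒≯ gt) = sym (T⇒≡ (<⇒<ᵇ gt))

∧-congʳ-if : ∀ a {b c} → (a ≡ true → b ≡ c) → a ∧ b ≡ a ∧ c
∧-congʳ-if true  eq = eq refl
∧-congʳ-if false eq = refl

∧-true : ∀ a {b} → a ∧ b ≡ true → a ≡ true × b ≡ true
∧-true true {true} refl = refl , refl

findFirst-just : ∀ {A : Set} {m} (p : A → Bool) (f : Fin m → A) {y} →
  findFirst p (tabulate f) ≡ just y →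
  ∃ λ k → f k ≡ y × p (f k) ≡ true × (∀ k′ → toℕ k′ < toℕ k → p (f k′) ≡ false)
findFirst-just {m = suc m} p f eq with p (f zero) in p₀
findFirst-just {m = suc m} p f refl | true = zero , refl , p₀ , λ _ ()
... | false with k , fk , pk , before ← findFirst-just p (f ∘ suc) eq =
  suc k , fk , pk , λ { zero _ → p₀ ; (suc k′) (s≤s lt) → before k′ lt }

findFirst-nothing : ∀ {A : Set} {m} (p : A → Bool) (f : Fin m → A) →
  findFirst p (tabulate f) ≡ nothing → ∀ k → p (f k) ≡ false
findFirst-nothing {m = suc m} p f eq k with p (f zero) in p₀
findFirst-nothing {m = suc m} p f eq zero    | false = p₀
findFirst-nothing {m = suc m} p f eq (suc k) | false = findFirst-nothing p (f ∘ suc) eq k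

-- Counts as sums of indicators

⟦_⟧ : Bool → ℕ
⟦ b ⟧ = if b then 1 else 0

count-tabulate : ∀ {A : Set} {m} (p : A → Bool) (f : Fin m → A) →
  count p (tabulate f) ≡ sum (⟦_⟧ ∘ p ∘ f)
count-tabulate {m = zero}  p f = refl
count-tabulate {m = suc m} p f with p (f zero)
... | true  = cong suc (count-tabulate p (f ∘ suc))
... | false = count-tabulate p (f ∘ suc)

sum-below-suc : ∀ {m} (X : Fin m → Bool) k →
  sum (λ j → ⟦ (toℕ j <ᵇ suc (toℕ k)) ∧ X j ⟧) ≡ ⟦ X k ⟧ + sum (λ j → ⟦ (toℕ j <ᵇ toℕ k) ∧ X j ⟧)
sum-below-suc X zero    = refl
sum-below-suc X (suc k) rewrite sum-below-suc (X ∘ suc) k =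
  +-*-Solver.solve 3 (λ a b c → a :+ (b :+ c) := b :+ (a :+ c)) refl ⟦ X zero ⟧ ⟦ X (suc k) ⟧ _
  where open +-*-Solver using (_:+_; _:=_)

ListAction-sum-tabulate : ∀ {A : Set} {m} (g : A → ℕ) (f : Fin m → A) →
  ListAction.sum (List.map g (tabulate f)) ≡ sum (g ∘ f)
ListAction-sum-tabulate {m = zero}  g f = refl
ListAction-sum-tabulate {m = suc m} g f = cong (g (f zero) +_) (ListAction-sum-tabulate g (f ∘ suc))

oddᵇ-+ : ∀ b c → oddᵇ (⟦ b ⟧ + c) ≡ b xor oddᵇ c
oddᵇ-+ true  c = refl
oddᵇ-+ false c = refl

-- Intervals

∈I-just : ∀ {n} {a b i : Fin n} → (i ∈I just (a , b)) ≡ true → toℕ a ≤ toℕ i × toℕ i ≤ toℕ b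
∈I-just {a = a} {b} {i} eq with ∧-true (toℕ a ≤ᵇ toℕ i) eq
... | l , r = ≤ᵇ⇒≤ _ _ (≡⇒T l) , ≤ᵇ⇒≤ _ _ (≡⇒T r)

just-∈I : ∀ {n} {a b i : Fin n} → toℕ a ≤ toℕ i → toℕ i ≤ toℕ b → (i ∈I just (a , b)) ≡ true
just-∈I a≤i i≤b = cong₂ _∧_ (T⇒≡ (≤⇒≤ᵇ a≤i)) (T⇒≡ (≤⇒≤ᵇ i≤b))

module _ {n} {x x′ y : Fin n} where

  -- `y` is outside the interval but above its member `x`, hence above its upper end. Convexity of
  -- intervals enters only here and in the mirror image `interval-above`.
  interval-below : (J : Interval n) → (x ∈I J) ≡ true → (x′ ∈I J) ≡ true → (y ∈I J) ≡ false →
    toℕ x < toℕ y → toℕ x′ < toℕ y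
  interval-below (just (a , b)) ix ix′ ny x<y = ≤-<-trans (proj₂ (∈I-just {a = a} ix′)) (≰⇒>
    λ y≤b → true≢false (just-∈I {a = a} {b} {y} (≤-trans (proj₁ (∈I-just {b = b} ix)) (<⇒≤ x<y)) y≤b) ny)

  interval-above : (J : Interval n) → (x ∈I J) ≡ true → (x′ ∈I J) ≡ true → (y ∈I J) ≡ false →
    toℕ y < toℕ x → toℕ y < toℕ x′
  interval-above (just (a , b)) ix ix′ ny y<x = <-≤-trans (≰⇒>
    λ a≤y → true≢false (just-∈I {a = a} {b} {y} a≤y (≤-trans (<⇒≤ y<x) (proj₂ (∈I-just {a = a} ix)))) ny)
    (proj₁ (∈I-just {b = b} ix′))

-- Inequalities between finite sums

sum-mono-≤ : ∀ {m} {f g : Fin m → ℕ} → (∀ k → f k ≤ g k) → sum f ≤ sum g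
sum-mono-≤ {zero}  f≤g = z≤n
sum-mono-≤ {suc m} f≤g = +-mono-≤ (f≤g zero) (sum-mono-≤ (f≤g ∘ suc))

sum-mono-< : ∀ {m} {f g : Fin m → ℕ} → (∀ k → f k ≤ g k) → ∀ k → f k < g k → sum f < sum g
sum-mono-< f≤g zero    lt = +-mono-<-≤ lt (sum-mono-≤ (f≤g ∘ suc))
sum-mono-< f≤g (suc k) lt = +-mono-≤-< (f≤g zero) (sum-mono-< (f≤g ∘ suc) k lt)

sum≢0 : ∀ {m} {f : Fin m → ℕ} → sum f ≢ 0 → ∃ λ k → f k ≢ 0
sum≢0 {zero} neq = contradiction refl neq
sum≢0 {suc m} {f} neq with f zero in f₀
... | suc _ = zero , λ eq → 1+n≢0 (trans (sym f₀) eq)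
... | zero with k , fk ← sum≢0 {f = f ∘ suc} neq = suc k , fk

sum-δ : ∀ {m} (i : Fin m) → sum (λ a → ⟦ a ==F i ⟧) ≡ 1
sum-δ {suc m} zero = cong suc (sum-replicate-zero m)
sum-δ {suc m} (suc i) = sum-δ i

sum-δ₂ : ∀ {m n} (i : Fin m) (j : Fin n) → sum (λ a → sum λ b → ⟦ (a ==F i) ∧ (b ==F j) ⟧) ≡ 1
sum-δ₂ {n = n} i j = trans (sum-cong-≗ row) (sum-δ i)
  where
  row : ∀ a → sum (λ b → ⟦ (a ==F i) ∧ (b ==F j) ⟧) ≡ ⟦ a ==F i ⟧
  row a with a ==F i
  ... | true  = sum-δ j
  ... | false = sum-replicate-zero n

-- With `p = suc q + x` and `u = suc w + y` the two sides differ by exactly `suc x * suc y`.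
rearrangement : ∀ {p q u w} → q < p → w < u → p * w + q * u < p * u + q * w
rearrangement {q = q} {w = w} q<p w<u
  with x , refl ← m≤n⇒∃[o]m+o≡n q<p | y , refl ← m≤n⇒∃[o]m+o≡n w<u = begin-strict
  (suc q + x) * w + q * (suc w + y)
    <⟨ m<m+n _ (s≤s z≤n) ⟩
  ((suc q + x) * w + q * (suc w + y)) + suc x * suc y
    ≡⟨ solve 4 (λ q w x y →
         ((con 1 :+ q :+ x) :* w :+ q :* (con 1 :+ w :+ y)) :+ (con 1 :+ x) :* (con 1 :+ y) :=
         (con 1 :+ q :+ x) :* (con 1 :+ w :+ y) :+ q :* w) refl q w x y ⟩
  (suc q + x) * (suc w + y) + q * w ∎
  where
  open ≤-Reasoning
  open +-*-Solver

-- Effect of a transposition on inversions and on weighted sums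

module Transposition {n} (i j : Fin n) where

  τ : Fin n → Fin n
  τ = transpose i j ⟨$⟩ʳ_

  -- Indexed by the value of `τ a`, so that matching on `view a` next to `τ a` also evaluates `τ a`.
  data View (a : Fin n) : Fin n → Set where
    at-i  : a ≡ i → View a j
    at-j  : a ≡ j → View a i
    fixed : a ≢ i → a ≢ j → View a a

  view : ∀ a → View a (τ a)
  view a with a Fin.≟ i
  ... | yes a≡i = at-i a≡i
  ... | no  a≢i with a Fin.≟ j
  ...   | yes a≡j = at-j a≡j
  ...   | no  a≢j = fixed a≢i a≢j

  τ-i : τ i ≡ j
  τ-i with τ i | view i
  ... | _ | at-i _ = refl
  ... | _ | at-j i≡j = i≡j
  ... | _ | fixed i≢i _ = contradiction refl i≢i

  τ-j : τ j ≡ i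
  τ-j with τ j | view j
  ... | _ | at-i j≡i = j≡i
  ... | _ | at-j _ = refl
  ... | _ | fixed _ j≢j = contradiction refl j≢j

  τ-involutive : ∀ a → τ (τ a) ≡ a
  τ-involutive a with τ a in eq | view a
  ... | _ | at-i refl = τ-j
  ... | _ | at-j refl = τ-i
  ... | _ | fixed _ _ = eq

  -- Relabelling both variables by the involution `τ` turns the right-hand count into that of the
  -- pairs with `P a b` and `τ a < τ b`. Every pair counted on the left is of this kind, except
  -- possibly `(i , j)`, which accounts for the `suc`.
  inversions-transpose : (P : Fin n → Fin n → Bool) →
    (∀ a b → toℕ a < toℕ b → P a b ≡ true → (toℕ (τ a) < toℕ (τ b)) ⊎ (a ≡ i × b ≡ j)) →
    sum (λ a → sum λ b → ⟦ (a <F b) ∧ P a b ⟧) ≤ suc (sum λ a → sum λ b → ⟦ (a <F b) ∧ P (τ a) (τ b) ⟧)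
  inversions-transpose P keep = begin
    (sum λ a → sum λ b → ⟦ (a <F b) ∧ P a b ⟧)
      ≤⟨ sum-mono-≤ (λ a → sum-mono-≤ (bound a)) ⟩
    (sum λ a → sum λ b → kept a b + new a b)
      ≡⟨ trans (sum-cong-≗ λ a → ∑-distrib-+ (kept a) (new a)) (∑-distrib-+ (sum ∘ kept) (sum ∘ new)) ⟩
    (sum λ a → sum (kept a)) + (sum λ a → sum (new a))
      ≡⟨ trans (cong (sum (sum ∘ kept) +_) (sum-δ₂ i j)) (+-comm _ 1) ⟩
    suc (sum λ a → sum (kept a))
      ≡⟨ cong suc (sym relabel) ⟩
    suc (sum λ a → sum λ b → ⟦ (a <F b) ∧ P (τ a) (τ b) ⟧) ∎
    where
    open ≤-Reasoning
    kept new : Fin n → Fin n → ℕ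
    kept a b = ⟦ (τ a <F τ b) ∧ P a b ⟧
    new a b = ⟦ (a ==F i) ∧ (b ==F j) ⟧
    bound : ∀ a b → ⟦ (a <F b) ∧ P a b ⟧ ≤ kept a b + new a b
    bound a b with bool? (a <F b) | bool? (P a b)
    ... | inj₂ nlt | _ rewrite nlt = z≤n
    ... | inj₁ lt | inj₂ np rewrite lt | np = z≤n
    ... | inj₁ lt | inj₁ p with keep a b (<F⇒< {i = a} lt) p
    ...   | inj₁ lt′ rewrite lt | p | <F-true lt′ = s≤s z≤n
    ...   | inj₂ (refl , refl) rewrite ==F-true {i = i} refl | ==F-true {i = j} refl | lt | p = m≤n+m 1 _
    relabel : (sum λ a → sum λ b → ⟦ (a <F b) ∧ P (τ a) (τ b) ⟧) ≡ (sum λ a → sum (kept a))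
    relabel = trans (sum-permute (λ a → sum λ b → ⟦ (a <F b) ∧ P (τ a) (τ b) ⟧) (transpose i j))
      (sum-cong-≗ λ a → trans (sum-permute (λ b → ⟦ (τ a <F b) ∧ P (τ (τ a)) (τ b) ⟧) (transpose i j))
        (sum-cong-≗ λ b → cong₂ (λ a′ b′ → ⟦ (τ a <F τ b) ∧ P a′ b′ ⟧) (τ-involutive a) (τ-involutive b)))

  -- Adding to each sum its image under the transposition makes the comparison termwise.
  weighted-sum-transpose : (c g : Fin n → ℕ) → c j < c i → g j < g i →
    sum (λ a → c a * g (τ a)) < sum (λ a → c a * g a)
  weighted-sum-transpose c g cj<ci gj<gi = ≰⇒> λ le → <⇒≱ doubled (+-mono-≤ le le)
    where
    L R : Fin n → ℕ
    L a = c a * g (τ a)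
    R a = c a * g a
    double : ∀ f → sum (λ a → f a + f (τ a)) ≡ sum f + sum f
    double f = trans (∑-distrib-+ f (f ∘ τ)) (cong (sum f +_) (sym (sum-permute f (transpose i j))))
    strict-i : c i * g j + c j * g i < c i * g i + c j * g j
    strict-i = rearrangement cj<ci gj<gi
    termwise : ∀ a → L a + L (τ a) ≤ R a + R (τ a)
    termwise a rewrite τ-involutive a with τ a | view a
    ... | _ | at-i refl = <⇒≤ strict-i
    ... | _ | at-j refl = ≤-trans (≤-reflexive (+-comm (c j * g i) _)) (≤-trans (<⇒≤ strict-i) (≤-reflexive (+-comm (c i * g i) _)))
    ... | _ | fixed _ _ = ≤-refl
    strict : L i + L (τ i) < R i + R (τ i)
    strict rewrite τ-involutive i | τ-i = strict-i
    doubled : sum L + sum L < sum R + sum R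
    doubled = subst₂ _<_ (double L) (double R) (sum-mono-< termwise i strict)

-- Single paths as trajectories

module Trajectories {n m : ℕ} (I : Fin m → Interval n) (S : Shape m) where
  open Net I S

  In : Fin m → Fin n → Bool
  In k i = i ∈I I k

  -- The index at which a trajectory shows the edge leaving a vertex. The edge into `x_j` is shown
  -- at `toℕ j`, hence the shift for `int j`. The value at a sink is a default, since no edge leaves
  -- a sink.
  time : Vertex n m → ℕ
  time (src _) = 0
  time (int j) = suc (toℕ j)
  time (snk _) = 0

  edge⇒raw : ∀ u i → T (isEdge u i) → rawExit u i ≡ true
  edge⇒raw u i e = T⇒≡ (proj₁ (Equivalence.to T-∧ e))

  -- Indexed by the target, so that matching on it next to `nextV u i` exposes the outcome of the
  -- search, in the same way for sources and interior vertices: `time u ≤ toℕ k` is `j < k` for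
  -- `int j` and holds trivially for a source.
  data Next (u : Vertex n m) (i : Fin n) : Vertex n m → Set where
    enters : ∀ k → time u ≤ toℕ k → In k i ≡ true →
             (∀ k′ → time u ≤ toℕ k′ → toℕ k′ < toℕ k → In k′ i ≡ false) → Next u i (int k)
    exits  : (∀ k′ → time u ≤ toℕ k′ → In k′ i ≡ false) → Next u i (snk i)

  next : ∀ u i → rawExit u i ≡ true → Next u i (nextV u i)
  next (src s) i raw with findFirst (λ k → i ∈I I k) (allFin m) in eq
  ... | just k with findFirst-just _ (λ k → k) eq
  ...   | .k , refl , ik , before = enters k z≤n ik (λ k′ _ → before k′)
  next (src s) i raw | nothing = exits (λ k′ _ → findFirst-nothing _ (λ k → k) eq k′)
  next (int j) i raw with findFirst (λ k → (j <F k) ∧ (i ∈I I k)) (allFin m) in eq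
  ... | just k with findFirst-just _ (λ k → k) eq
  ...   | .k , refl , ik , before with Equivalence.to T-∧ (≡⇒T ik)
  ...     | j<k , in-k = enters k (<ᵇ⇒< _ _ j<k) (T⇒≡ in-k) λ k′ j<k′ k′<k →
              trans (sym (cong (_∧ In k′ i) (<F-true j<k′))) (before k′ k′<k)
  next (int j) i raw | nothing = exits λ k′ j<k′ →
    trans (sym (cong (_∧ In k′ i) (<F-true j<k′))) (findFirst-nothing _ (λ k → k) eq k′)

  -- A trajectory sends t to the wire of the edge used just before x_t:
  -- the path enters x_k on wire r k and leaves it on wire r (suc k).
  Trajectory : Set
  Trajectory = ℕ → Fin n

  -- A path through `x_k` may leave by any edge, whatever wire it came in on; this freedom is what
  -- permits exchanging two paths at a common vertex.
  Step : Fin m → Fin n → Fin n → Set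
  Step k x y = (In k x ≡ true → T (isEdge (int k) y)) × (In k x ≡ false → y ≡ x)

  step-in : ∀ {k x y} → Step k x y → In k x ≡ true → In k y ≡ true
  step-in {k} {x} {y} st ix = edge⇒raw (int k) y (proj₁ st ix)

  module _ {k x x′ y y′} (sx : Step k x x′) (sy : Step k y y′) (apart : (In k x ∧ In k y) ≡ false) where

    -- At most one of the paths passes through `x_k`. It stays within the interval there, which lies
    -- wholly on one side of the other path's wire.
    step-< : toℕ x < toℕ y → toℕ x′ < toℕ y′
    step-< x<y with bool? (In k x) | bool? (In k y)
    ... | inj₁ ix | inj₁ iy rewrite ix | iy = contradiction apart λ ()
    ... | inj₁ ix | inj₂ ny rewrite proj₂ sy ny = interval-below (I k) ix (step-in sx ix) ny x<y
    ... | inj₂ nx | inj₁ iy rewrite proj₂ sx nx = interval-above (I k) iy (step-in sy iy) nx x<y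
    ... | inj₂ nx | inj₂ ny rewrite proj₂ sx nx | proj₂ sy ny = x<y

  module _ {k x x′ y y′} (sx : Step k x x′) (sy : Step k y y′) (apart : (In k x ∧ In k y) ≡ false) where

    private
      apart′ : (In k y ∧ In k x) ≡ false
      apart′ = trans (∧-comm (In k y) (In k x)) apart

    step-<F : x ≢ y → (x′ <F y′) ≡ (x <F y)
    step-<F x≢y with <-cmp (toℕ x) (toℕ y)
    ... | tri< lt _ _ = trans (<F-true (step-< sx sy apart lt)) (sym (<F-true lt))
    ... | tri≈ _ eq _ = contradiction (toℕ-injective eq) x≢y
    ... | tri> _ _ gt = trans (<F-false (<⇒≯ (step-< sy sx apart′ gt))) (sym (<F-false (<⇒≯ gt)))

    step-≢ : x ≢ y → x′ ≢ y′
    step-≢ x≢y refl with <-cmp (toℕ x) (toℕ y)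
    ... | tri< lt _ _ = <-irrefl refl (step-< sx sy apart lt)
    ... | tri≈ _ eq _ = x≢y (toℕ-injective eq)
    ... | tri> _ _ gt = <-irrefl refl (step-< sy sx apart′ gt)

    -- The reverse order is excluded by `step-<`. If `x` and `y` coincide, `apart` means that
    -- neither path passes through `x_k`, so neither wire changes.
    step-reflects-< : toℕ x′ < toℕ y′ → toℕ x < toℕ y
    step-reflects-< x′<y′ with <-cmp (toℕ x) (toℕ y)
    ... | tri< lt _ _ = lt
    ... | tri> _ _ gt = contradiction x′<y′ (<⇒≯ (step-< sy sx apart′ gt))
    ... | tri≈ _ eq _ with toℕ-injective eq | bool? (In k x)
    ...   | refl | inj₁ ix rewrite ix = contradiction apart λ ()
    ...   | refl | inj₂ nx rewrite proj₂ sx nx | proj₂ sy nx = x′<y′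

  ConstantOn : ℕ → ℕ → Trajectory → Fin n → Set
  ConstantOn a b r i = ∀ t → a ≤ t → t ≤ b → r t ≡ i

  -- An edge may bypass several vertices while a trajectory has one value for each time, so the wire
  -- of an edge must persist from its tail to its head.
  data Follows (r : Trajectory) : Vertex n m → List (Fin n) → Set where
    stop : ∀ {u i} → T (isEdge u i) → nextV u i ≡ snk i →
           (∀ k → time u ≤ toℕ k → In k i ≡ false) →
           ConstantOn (time u) m r i → Follows r u (i ∷ [])
    go   : ∀ {u i k ws} → T (isEdge u i) → nextV u i ≡ int k → time u ≤ toℕ k →
           In k i ≡ true →
           (∀ k′ → time u ≤ toℕ k′ → toℕ k′ < toℕ k → In k′ i ≡ false) →
           ConstantOn (time u) (toℕ k) r i →
           Follows r (int k) ws → Follows r u (i ∷ ws)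

  Follows-cong : ∀ {r r′ u ws} → (∀ t → time u ≤ t → r t ≡ r′ t) → Follows r u ws → Follows r′ u ws
  Follows-cong eq (stop e nx out c) = stop e nx out λ t a b → trans (sym (eq t a)) (c t a b)
  Follows-cong eq (go e nx le ik out c f) =
    go e nx le ik out (λ t a b → trans (sym (eq t a)) (c t a b))
      (Follows-cong (λ t a → eq t (≤-trans le (<⇒≤ a))) f)

  Follows-edge : ∀ {r u ws} → time u ≤ m → Follows r u ws → T (isEdge u (r (time u)))
  Follows-edge {u = u} le (stop e nx out c) = subst (T ∘ isEdge u) (sym (c _ ≤-refl le)) e
  Follows-edge {u = u} _ (go e nx le ik out c f) = subst (T ∘ isEdge u) (sym (c _ ≤-refl le)) e

  -- Reduces a whole path to local conditions, one for each vertex; `follow` goes back.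
  Follows-step : ∀ {r u ws} → Follows r u ws → ∀ k → time u ≤ toℕ k → Step k (r (toℕ k)) (r (suc (toℕ k)))
  Follows-step (stop e nx out c) k le
    rewrite c (toℕ k) le (<⇒≤ (toℕ<n k)) | c (suc (toℕ k)) (m≤n⇒m≤1+n le) (toℕ<n k) =
    (λ ik → true≢false ik (out k le)) , (λ _ → refl)
  Follows-step {r} {u} (go {k = k₀} e nx le₀ ik out c f) k le with <-cmp (toℕ k) (toℕ k₀)
  ... | tri< lt _ _ rewrite c (toℕ k) le (<⇒≤ lt) | c (suc (toℕ k)) (m≤n⇒m≤1+n le) lt =
    (λ ik → true≢false ik (out k le lt)) , (λ _ → refl)
  ... | tri≈ _ eq _ with toℕ-injective eq
  ...   | refl rewrite c (toℕ k) le ≤-refl =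
    (λ _ → Follows-edge (toℕ<n k) f) , (λ ik′ → true≢false ik ik′)
  Follows-step {r} {u} (go {k = k₀} e nx le₀ ik out c f) k le | tri> _ _ gt = Follows-step f k gt

  Follows⇒Valid : ∀ {r u ws} → time u ≤ m → Follows r u ws → Valid u ws (snk (r m))
  Follows⇒Valid le (stop e nx out c) = e , trans nx (cong snk (sym (c _ le ≤-refl)))
  Follows⇒Valid {r} {u} _ (go {k = k} {ws = ws} e nx le ik out c f) =
    e , subst (λ w → Valid w ws (snk (r m))) (sym nx) (Follows⇒Valid (toℕ<n k) f)

  Valid⇒Follows : ∀ u ws {z} → (∀ z′ → u ≢ snk z′) → Valid u ws (snk z) →
    ∃ λ r → Follows r u ws × r m ≡ z
  Valid⇒Follows u [] ¬snk eq = ⊥-elim (¬snk _ eq)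
  Valid⇒Follows u (i ∷ ws) ¬snk (e , val) with nextV u i in nx | next u i (edge⇒raw u i e)
  ... | .(snk i) | exits out with ws | val
  ...   | []    | refl = (λ _ → i) , stop e nx out (λ _ _ _ → refl) , refl
  ...   | _ ∷ _ | () , _
  Valid⇒Follows u (i ∷ ws) ¬snk (e , val) | .(int k) | enters k le ik out
    with r , f , rm ← Valid⇒Follows (int k) ws (λ _ ()) val =
    glued ,
    go e nx le ik out (λ t _ t≤k → cong (if_then i else r t) (T⇒≡ (≤⇒≤ᵇ t≤k)))
      (Follows-cong (λ t k<t → sym (late t k<t)) f) ,
    trans (late m (toℕ<n k)) rm
    where
    -- The trajectory of the remaining word is unconstrained up to time `toℕ k`; there it is
    -- overwritten by the wire of the first edge.
    glued : Trajectory
    glued t = if t ≤ᵇ toℕ k then i else r t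
    late : ∀ t → toℕ k < t → glued t ≡ r t
    late t k<t = cong (if_then i else r t) (¬T⇒≡ (<⇒≱ k<t ∘ ≤ᵇ⇒≤ _ _))

  constant-until : ∀ (r : Trajectory) {a b i} →
    (∀ k → a ≤ toℕ k → Step k (r (toℕ k)) (r (suc (toℕ k)))) → r a ≡ i → b ≤ m →
    (∀ k → a ≤ toℕ k → toℕ k < b → In k i ≡ false) → ConstantOn a b r i
  constant-until r {a} st ra b≤m out zero z≤n _ = ra
  constant-until r {a} {b} st ra b≤m out (suc t) a≤t t≤b with m≤n⇒m<n∨m≡n a≤t
  ... | inj₂ refl = ra
  ... | inj₁ (s≤s a≤t′) = trans (subst (λ s → r (suc s) ≡ r s) k≡t same) rt
    where
    rt = constant-until r st ra b≤m out t a≤t′ (<⇒≤ t≤b)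
    k  = fromℕ< (<-≤-trans t≤b b≤m)
    k≡t : toℕ k ≡ t
    k≡t = toℕ-fromℕ< _
    a≤k : a ≤ toℕ k
    a≤k = subst (a ≤_) (sym k≡t) a≤t′
    same : r (suc (toℕ k)) ≡ r (toℕ k)
    same = proj₂ (st k a≤k) (trans (cong (In k) (trans (cong r k≡t) rt))
                                   (out k a≤k (subst (_< b) (sym k≡t) t≤b)))

  -- The fuel bounds the number of vertices x_k that are still ahead of u.
  follow : ∀ (r : Trajectory) fuel u → m ≤ fuel + time u → T (isEdge u (r (time u))) →
    (∀ k → time u ≤ toℕ k → Step k (r (toℕ k)) (r (suc (toℕ k)))) → ∃ (Follows r u)
  follow r fuel u m≤ e st with nextV u (r (time u)) in nx | next u _ (edge⇒raw u _ e)
  ... | _ | exits out = _ , stop e nx out (constant-until r st refl ≤-refl (λ k le _ → out k le))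
  follow r zero u m≤ e st | _ | enters k le ik out = contradiction (toℕ<n k) (≤⇒≯ (≤-trans m≤ le))
  follow r (suc fuel) u m≤ e st | _ | enters k le ik out =
    _ , go e nx le ik out c (proj₂ (follow r fuel (int k) m≤′ e′ λ k′ lt → st k′ (≤-trans le (<⇒≤ lt))))
    where
    c : ConstantOn (time u) (toℕ k) r (r (time u))
    c = constant-until r st refl (<⇒≤ (toℕ<n k)) out
    e′ : T (isEdge (int k) (r (suc (toℕ k))))
    e′ = proj₁ (st k le) (trans (cong (In k) (c _ le ≤-refl)) ik)
    m≤′ : m ≤ fuel + suc (toℕ k)
    m≤′ = ≤-trans m≤ (≤-trans (≤-reflexive (sym (+-suc fuel (time u)))) (+-monoʳ-≤ fuel (s≤s le)))

  -- Edges of a path read off from its trajectory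

  ==V-true : ∀ {u w} → u ≡ w → (u ==V w) ≡ true
  ==V-true {src i} refl = ==F-true {i = i} refl
  ==V-true {int i} refl = ==F-true {i = i} refl
  ==V-true {snk i} refl = ==F-true {i = i} refl

  ==V-time : ∀ u w → time u ≢ time w → (u ==V w) ≡ false
  ==V-time (src _) (src _) neq = contradiction refl neq
  ==V-time (src _) (int _) neq = refl
  ==V-time (src _) (snk _) neq = refl
  ==V-time (int _) (src _) neq = refl
  ==V-time (int _) (int _) neq = ==F-false (neq ∘ cong (suc ∘ toℕ))
  ==V-time (int _) (snk _) neq = refl
  ==V-time (snk _) (src _) neq = refl
  ==V-time (snk _) (int _) neq = refl
  ==V-time (snk _) (snk _) neq = contradiction refl neq

  int-==V-false : ∀ {j k} → j ≢ k → (int j ==V int k) ≡ false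
  int-==V-false = ==F-false

  -- Wire `i` enters `x_k` from the last vertex before `x_k` on that wire: an edge from an earlier
  -- one would have stopped there. So an incoming edge is determined by its wire.
  arrival-unique : ∀ {u w k i} → rawExit u i ≡ true → rawExit w i ≡ true →
    nextV u i ≡ int k → nextV w i ≡ int k → u ≡ w
  arrival-unique {u} {w} {k} {i} ru rw nu nw = compare u w ru rw (arrival ru nu) (arrival rw nw)
    where
    arrival : ∀ {u} → rawExit u i ≡ true → nextV u i ≡ int k → Next u i (int k)
    arrival {u} r eq = subst (Next u i) eq (next u i r)
    compare : ∀ u w → rawExit u i ≡ true → rawExit w i ≡ true →
              Next u i (int k) → Next w i (int k) → u ≡ w
    compare (src s) (src t) ru rw _ _ = cong src (trans (==F⇒≡ {i = s} ru) (sym (==F⇒≡ {i = t} rw)))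
    compare (src s) (int j) ru rw (enters _ _ _ out) (enters _ j<k _ _) = true≢false rw (out j z≤n j<k)
    compare (int j) (src s) ru rw (enters _ j<k _ _) (enters _ _ _ out) = true≢false ru (out j z≤n j<k)
    compare (int j) (int l) ru rw (enters _ j<k _ outj) (enters _ l<k _ outl) with <-cmp (toℕ j) (toℕ l)
    ... | tri< j<l _ _ = true≢false rw (outj l j<l l<k)
    ... | tri≈ _ eq _ = cong int (toℕ-injective eq)
    ... | tri> _ _ l<j = true≢false ru (outl j l<j j<k)

  arrives : Fin m → Vertex n m × Fin n → Bool
  arrives k e = nextV (proj₁ e) (proj₂ e) ==V int k

  leaves : Fin m → Vertex n m × Fin n → Bool
  leaves k e = proj₁ e ==V int k

  no-arrival : ∀ {r u ws k} → Follows r u ws → toℕ k < time u → findFirst (arrives k) (steps u ws) ≡ nothing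
  no-arrival (stop _ nx _ _) _ rewrite nx = refl
  no-arrival {k = k} (go {k = k₀} _ nx le _ _ _ f) lt
    rewrite nx | int-==V-false {k₀} {k} (λ { refl → <⇒≱ lt le }) = no-arrival f (m≤n⇒m≤1+n (≤-trans lt le))

  -- Evaluates the search in `inE`. The tail is only asserted to exist; `arrival-unique` makes this
  -- enough.
  arrival-edge : ∀ {r u ws k} → Follows r u ws → time u ≤ toℕ k → In k (r (toℕ k)) ≡ true →
    ∃ λ w → findFirst (arrives k) (steps u ws) ≡ just (w , r (toℕ k)) ×
            rawExit w (r (toℕ k)) ≡ true × nextV w (r (toℕ k)) ≡ int k
  arrival-edge {k = k} (stop e nx out c) le ik rewrite c (toℕ k) le (<⇒≤ (toℕ<n k)) = true≢false ik (out k le)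
  arrival-edge {u = u} {k = k} (go {i = i} {k = k₀} e nx le₀ ik₀ out c f) le ik with <-cmp (toℕ k) (toℕ k₀)
  ... | tri< lt _ _ rewrite c (toℕ k) le (<⇒≤ lt) = true≢false ik (out k le lt)
  ... | tri> _ neq gt rewrite nx | int-==V-false {k₀} {k} (λ { refl → neq refl }) = arrival-edge f gt ik
  ... | tri≈ _ eq _ with toℕ-injective eq
  ...   | refl rewrite c (toℕ k) le ≤-refl =
    u , if-true (trans (cong (_==V int k) nx) (==V-true {int k} refl)) ,
    edge⇒raw u i e , nx

  arrival-none : ∀ {r u ws k} → Follows r u ws → time u ≤ toℕ k → In k (r (toℕ k)) ≡ false →
    findFirst (arrives k) (steps u ws) ≡ nothing
  arrival-none (stop _ nx _ _) le ik rewrite nx = refl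
  arrival-none {k = k} (go {k = k₀} e nx le₀ ik₀ out c f) le ik with <-cmp (toℕ k) (toℕ k₀)
  ... | tri< lt neq _ rewrite nx | int-==V-false {k₀} {k} (λ { refl → neq refl }) = no-arrival f (m≤n⇒m≤1+n lt)
  ... | tri> _ neq gt rewrite nx | int-==V-false {k₀} {k} (λ { refl → neq refl }) = arrival-none f gt ik
  ... | tri≈ _ eq _ with toℕ-injective eq
  ...   | refl rewrite c (toℕ k) le ≤-refl = true≢false ik₀ ik

  departure-now : ∀ {r k ws} → Follows r (int k) ws →
    findFirst (leaves k) (steps (int k) ws) ≡ just (int k , r (suc (toℕ k)))
  departure-now {k = k} (stop e nx out c) =
    trans (if-true (==V-true {int k} refl)) (cong (λ i → just (int k , i)) (sym (c _ ≤-refl (toℕ<n k))))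
  departure-now {k = k} (go e nx le ik out c f) =
    trans (if-true (==V-true {int k} refl)) (cong (λ i → just (int k , i)) (sym (c _ ≤-refl le)))

  departure-edge : ∀ {r u ws k} → Follows r u ws → time u ≤ toℕ k → In k (r (toℕ k)) ≡ true →
    findFirst (leaves k) (steps u ws) ≡ just (int k , r (suc (toℕ k)))
  departure-edge {k = k} (stop e nx out c) le ik rewrite c (toℕ k) le (<⇒≤ (toℕ<n k)) = true≢false ik (out k le)
  departure-edge {u = u} {k = k} (go {k = k₀} e nx le₀ ik₀ out c f) le ik
    rewrite ==V-time u (int k) (λ eq → <⇒≢ (s≤s le) eq) | nx with <-cmp (toℕ k) (toℕ k₀)
  ... | tri< lt _ _ rewrite c (toℕ k) le (<⇒≤ lt) = true≢false ik (out k le lt)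
  ... | tri> _ _ gt = departure-edge f gt ik
  ... | tri≈ _ eq _ with toℕ-injective eq
  ...   | refl = departure-now f

  traverses : Vertex n m → Fin n → Vertex n m × Fin n → Bool
  traverses u i e = (proj₁ e ==V u) ∧ (proj₂ e ==F i)

  traversals-past : ∀ {r u ws} w i → Follows r u ws → time w < time u → count (traverses w i) (steps u ws) ≡ 0
  traversals-past {u = u} w i (stop _ nx _ _) lt rewrite ==V-time u w (<⇒≢ lt ∘ sym) = refl
  traversals-past {u = u} w i (go _ nx le _ _ _ f) lt rewrite ==V-time u w (<⇒≢ lt ∘ sym) | nx =
    traversals-past w i f (s≤s (≤-trans (<⇒≤ lt) le))

  traversals-now : ∀ {r u ws} i → time u ≤ m → Follows r u ws →
    count (traverses u i) (steps u ws) ≡ (if r (time u) ==F i then 1 else 0)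
  traversals-now {u = u} i le (stop e nx out c) rewrite ==V-true {u} refl | c _ ≤-refl le = refl
  traversals-now {u = u} i _ (go e nx le ik out c f)
    rewrite ==V-true {u} refl | c _ ≤-refl le | nx | traversals-past u i f (s≤s le) = refl

  -- Times increase along a path, so `int k` is left at most once. On a path that bypasses `x_k`,
  -- the wire at `suc (toℕ k)` misses the interval of `x_k` and so differs from `i`.
  traversals : ∀ {r u ws k} i → Follows r u ws → time u ≤ toℕ k → In k i ≡ true →
    count (traverses (int k) i) (steps u ws) ≡ (if r (suc (toℕ k)) ==F i then 1 else 0)
  traversals {u = u} {k = k} i (stop {i = i₀} e nx out c) le ik
    rewrite ==V-time u (int k) (<⇒≢ (s≤s le)) | c (suc (toℕ k)) (m≤n⇒m≤1+n le) (toℕ<n k)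
          | ==F-false {i = i₀} {i} (λ { refl → true≢false ik (out k le) }) = refl
  traversals {u = u} {k = k} i (go {i = i₀} {k = k₀} e nx le₀ ik₀ out c f) le ik
    rewrite ==V-time u (int k) (<⇒≢ (s≤s le)) | nx with <-cmp (toℕ k) (toℕ k₀)
  ... | tri< lt _ _
    rewrite c (suc (toℕ k)) (m≤n⇒m≤1+n le) lt | ==F-false {i = i₀} {i} (λ { refl → true≢false ik (out k le lt) }) =
    traversals-past (int k) i f (s≤s lt)
  ... | tri> _ _ gt = traversals i f gt ik
  ... | tri≈ _ eq _ with toℕ-injective eq
  ...   | refl = traversals-now i (toℕ<n k) f

  traversals-other-source : ∀ {r s s′ ws} i → Follows r (src s) ws → (s ==F s′) ≡ false →
    count (traverses (src s′) i) (steps (src s) ws) ≡ 0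
  traversals-other-source i (stop e nx out c) differ rewrite differ = refl
  traversals-other-source i (go e nx le ik out c f) differ rewrite differ | nx = traversals-past _ i f (s≤s z≤n)

  uses-spec : ∀ {r s t} (p : Path s t) u i → Follows r (src s) (Path.ws p) → T (isEdge u i) →
    usesEdge p u i ≡ (r (time u) ==F i)
  uses-spec {r} {s} p (int k) i f e rewrite traversals {k = k} i f z≤n (edge⇒raw (int k) i e)
    with r (suc (toℕ k)) ==F i
  ... | true  = refl
  ... | false = refl
  -- At a source `rawExit` forces the wire to be the label of the source.
  uses-spec {r} {s} p (src s′) i f e with ==F⇒≡ {i = s} (edge⇒raw (src s) _ (Follows-edge z≤n f))
                                        | ==F⇒≡ {i = s′} (edge⇒raw (src s′) i e) | bool? (s ==F s′)
  ... | r₀ | refl | inj₁ same with ==F⇒≡ {i = s} same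
  ...   | refl rewrite traversals-now i z≤n f with r 0 ==F i
  ...     | true  = refl
  ...     | false = refl
  uses-spec {r} {s} p (src s′) i f e | r₀ | refl | inj₂ differ
    rewrite traversals-other-source {s′ = s′} i f differ = sym (trans (cong (_==F i) (sym r₀)) differ)

  same-arrival : ∀ {u w i j k} → rawExit u i ≡ true → rawExit w j ≡ true →
    nextV u i ≡ int k → nextV w j ≡ int k → (u ==V w) ∧ (i ==F j) ≡ (i ==F j)
  same-arrival {u} {w} {i} {j} ru rw nu nw with bool? (i ==F j)
  ... | inj₂ i≠j rewrite i≠j = ∧-zeroʳ (u ==V w)
  ... | inj₁ i=j with ==F⇒≡ {i = i} i=j
  ...   | refl rewrite ==V-true {u} {w} (arrival-unique {u} {w} ru rw nu nw) = refl

  -- Crossing parity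

  module Pair {s t s′ t′ : Fin n} (p : Path s t) (q : Path s′ t′) {x y : Trajectory}
              (fx : Follows x (src s) (Path.ws p)) (fy : Follows y (src s′) (Path.ws q)) where

    X Y : Fin m → Fin n
    X = x ∘ toℕ
    Y = y ∘ toℕ

    -- `meet` compares edges, but by `same-arrival` edges into `x_k` are equal as soon as their
    -- wires are.
    meet-spec : ∀ k → meet p q k ≡ (In k (X k) ∧ In k (Y k)) ∧ not (X k ==F Y k)
    meet-spec k with bool? (In k (X k)) | bool? (In k (Y k))
    ... | inj₂ nx | _ rewrite nx | arrival-none {k = k} fx z≤n nx = refl
    ... | inj₁ ix | inj₂ ny rewrite ix | ny | arrival-none {k = k} fy z≤n ny with inE p k
    ...   | just _  = refl
    ...   | nothing = refl
    meet-spec k | inj₁ ix | inj₁ iy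
      with u , eu , ru , nu ← arrival-edge {k = k} fx z≤n ix | w , ew , rw , nw ← arrival-edge {k = k} fy z≤n iy
      rewrite ix | iy | eu | ew | same-arrival {u} {w} ru rw nu nw = refl

    enterBelow-spec : ∀ k → In k (X k) ≡ true → In k (Y k) ≡ true → enterBelow p q k ≡ (X k <F Y k)
    enterBelow-spec k ix iy
      with u , eu , _ ← arrival-edge {k = k} fx z≤n ix | w , ew , _ ← arrival-edge {k = k} fy z≤n iy
      rewrite eu | ew = refl

    Xs Ys : Fin m → Fin n
    Xs = x ∘ suc ∘ toℕ
    Ys = y ∘ suc ∘ toℕ

    outW-x : ∀ k → In k (X k) ≡ true → outW p k ≡ just (Xs k)
    outW-x k ix rewrite departure-edge {k = k} fx z≤n ix = refl

    outW-y : ∀ k → In k (Y k) ≡ true → outW q k ≡ just (Ys k)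
    outW-y k iy rewrite departure-edge {k = k} fy z≤n iy = refl

    -- T is the first time after entering x_k at which the paths are on different edges.
    exit-spec : ∀ fuel k T → toℕ k < T → T ≤ m → T ≤ fuel + toℕ k →
      In k (X k) ≡ true → In k (Y k) ≡ true →
      (∀ t → toℕ k < t → t < T → x t ≡ y t) → x T ≢ y T →
      exitBelowF p q fuel k ≡ just (x T <F y T)
    exit-spec zero k T k<T _ T≤k _ _ _ _ = contradiction k<T (≤⇒≯ T≤k)
    exit-spec (suc fuel) k T k<T T≤m T≤ ix iy same differ
      rewrite outW-x k ix | outW-y k iy with bool? (Xs k ==F Ys k) | m≤n⇒m<n∨m≡n k<T
    ... | inj₂ neq | inj₂ refl rewrite neq = refl
    ... | inj₂ neq | inj₁ lt = true≢false (==F-true (same _ ≤-refl lt)) neq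
    ... | inj₁ eq  | inj₂ refl = contradiction (==F⇒≡ {i = Xs k} eq) differ
    -- Both paths leave `x_k` on one edge and agree up to its end, so `T` lies beyond that end and
    -- the search continues at the next common vertex.
    ... | inj₁ eq  | inj₁ lt rewrite eq = onward _ (next (int k) (Xs k) (step-in (Follows-step fx k z≤n) ix))
      where
      constant-x : ∀ {b} → b ≤ m → (∀ k′ → toℕ k < toℕ k′ → toℕ k′ < b → In k′ (Xs k) ≡ false) →
                   ConstantOn (suc (toℕ k)) b x (Xs k)
      constant-x = constant-until x (λ k′ _ → Follows-step fx k′ z≤n) refl
      constant-y : ∀ {b} → b ≤ m → (∀ k′ → toℕ k < toℕ k′ → toℕ k′ < b → In k′ (Xs k) ≡ false) →
                   ConstantOn (suc (toℕ k)) b y (Xs k)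
      constant-y = constant-until y (λ k′ _ → Follows-step fy k′ z≤n) (sym (same _ ≤-refl lt))
      onward : ∀ w → Next (int k) (Xs k) w → continue p q fuel w ≡ just (x T <F y T)
      onward _ (exits out) = contradiction
        (trans (constant-x ≤-refl (λ k′ a _ → out k′ a) T k<T T≤m)
               (sym (constant-y ≤-refl (λ k′ a _ → out k′ a) T k<T T≤m)))
        differ
      onward _ (enters k′ k<k′ ik′ out) with <-≤-connex (toℕ k′) T
      ... | inj₂ T≤k′ = contradiction
        (trans (constant-x (<⇒≤ (toℕ<n k′)) out T k<T T≤k′) (sym (constant-y (<⇒≤ (toℕ<n k′)) out T k<T T≤k′)))
        differ
      ... | inj₁ k′<T = exit-spec fuel k′ T k′<T T≤m
        (≤-trans T≤ (≤-trans (≤-reflexive (sym (+-suc fuel (toℕ k)))) (+-monoʳ-≤ fuel k<k′)))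
        (trans (cong (In k′) (constant-x (<⇒≤ (toℕ<n k′)) out _ k<k′ ≤-refl)) ik′)
        (trans (cong (In k′) (constant-y (<⇒≤ (toℕ<n k′)) out _ k<k′ ≤-refl)) ik′)
        (λ t k′<t → same t (<-trans k<k′ k′<t)) differ

    crossing-met : ∀ {k b} → exitBelowF p q (suc m) k ≡ just b → meet p q k ≡ true →
      crossingAt p q k ≡ b xor enterBelow p q k
    crossing-met {k} {b} eq mt rewrite eq | mt with b | enterBelow p q k
    ... | true  | true  = refl
    ... | true  | false = refl
    ... | false | true  = refl
    ... | false | false = refl

    crossing-unmet : ∀ {k} → meet p q k ≡ false → crossingAt p q k ≡ false
    crossing-unmet {k} mt with exitBelowF p q (suc m) k
    ... | just _  rewrite mt = refl
    ... | nothing = refl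

    crossingsUntil : ℕ → ℕ
    crossingsUntil t = sum (λ k → ⟦ (toℕ k <ᵇ t) ∧ crossingAt p q k ⟧)

    -- While the paths share an edge their wires are not ordered, so the order is read at `T`, the
    -- first time from `t` on at which they differ. This fits `crossingAt`, which books a crossing
    -- at the initial vertex of a component although the order changes only at its exit.
    ParityAt : ℕ → Set
    ParityAt t = ∀ T → t ≤ T → T ≤ m → (∀ u → t ≤ u → u < T → x u ≡ y u) → x T ≢ y T →
      oddᵇ (crossingsUntil t) ≡ not (x T <F y T)

    parity-now : ∀ {k} → ParityAt (toℕ k) → X k ≢ Y k → oddᵇ (crossingsUntil (toℕ k)) ≡ not (X k <F Y k)
    parity-now {k} par = par (toℕ k) ≤-refl (<⇒≤ (toℕ<n k)) (λ u k≤u u<k → contradiction u<k (≤⇒≯ k≤u))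

    stepX : ∀ k → Step k (X k) (Xs k)
    stepX k = Follows-step fx k z≤n

    stepY : ∀ k → Step k (Y k) (Ys k)
    stepY k = Follows-step fy k z≤n

    -- If the wires agree before `x_k`, nothing is met and the same `T` serves. If they differ and
    -- some path bypasses `x_k`, nothing is met, the order is kept, and `T` is `suc (toℕ k)`. If
    -- both pass on different wires, the crossing bit is the exclusive or of exit order and entry
    -- order, and the latter cancels against the induction hypothesis.
    parity-suc : ∀ k → ParityAt (toℕ k) → ParityAt (suc (toℕ k))
    parity-suc k ih T k<T T≤m same differ
      rewrite sum-below-suc (crossingAt p q) k | oddᵇ-+ (crossingAt p q k) (crossingsUntil (toℕ k))
      with bool? (X k ==F Y k) | bool? (In k (X k) ∧ In k (Y k))
    ... | inj₁ eq | _
      rewrite crossing-unmet {k} (trans (meet-spec k)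
        (trans (cong (λ b → (In k (X k) ∧ In k (Y k)) ∧ not b) eq) (∧-zeroʳ _))) =
      ih T (<⇒≤ k<T) T≤m same′ differ
      where
      same′ : ∀ u → toℕ k ≤ u → u < T → x u ≡ y u
      same′ u k≤u u<T with m≤n⇒m<n∨m≡n k≤u
      ... | inj₁ lt   = same u lt u<T
      ... | inj₂ refl = ==F⇒≡ {i = X k} eq
    ... | inj₂ neq | inj₂ apart
      rewrite crossing-unmet {k} (trans (meet-spec k) (cong (_∧ not (X k ==F Y k)) apart))
      with m≤n⇒m<n∨m≡n k<T
    ...   | inj₁ lt   = contradiction (same _ ≤-refl lt) (step-≢ (stepX k) (stepY k) apart (==F⇒≢ neq))
    ...   | inj₂ refl = trans (parity-now ih (==F⇒≢ neq)) (cong not (sym (step-<F (stepX k) (stepY k) apart (==F⇒≢ neq))))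
    parity-suc k ih T k<T T≤m same differ | inj₂ neq | inj₁ both with ∧-true (In k (X k)) both
    ... | ix , iy
      rewrite crossing-met {k} (exit-spec (suc m) k T k<T T≤m (≤-trans T≤m (m≤n⇒m≤1+n (m≤m+n m _))) ix iy same differ)
                               (trans (meet-spec k) (cong₂ (λ b c → b ∧ not c) both neq))
            | enterBelow-spec k ix iy | parity-now ih (==F⇒≢ neq) = xor-cancel (x T <F y T) (X k <F Y k)
      where
      xor-cancel : ∀ b e → (b xor e) xor not e ≡ not b
      xor-cancel true  true  = refl
      xor-cancel true  false = refl
      xor-cancel false true  = refl
      xor-cancel false false = refl

    start-x : x 0 ≡ s
    start-x = sym (==F⇒≡ {i = s} (edge⇒raw (src s) _ (Follows-edge z≤n fx)))

    start-y : y 0 ≡ s′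
    start-y = sym (==F⇒≡ {i = s′} (edge⇒raw (src s′) _ (Follows-edge z≤n fy)))

    parity : toℕ s < toℕ s′ → ∀ t → t ≤ m → ParityAt t
    -- No crossing is booked before time 0, and the sources are distinct, so `T` is 0 and the order
    -- is that of the sources.
    parity s<s′ zero _ zero _ _ _ _ rewrite start-x | start-y | <F-true s<s′ = cong oddᵇ (sum-replicate-zero m)
    parity s<s′ zero _ (suc T) _ _ same _ =
      contradiction s<s′ (<-irrefl (cong toℕ (trans (sym start-x) (trans (same 0 z≤n (s≤s z≤n)) start-y))))
    parity s<s′ (suc t) t<m = subst (λ u → ParityAt u → ParityAt (suc u)) (toℕ-fromℕ< t<m)
      (parity-suc (fromℕ< t<m)) (parity s<s′ t (<⇒≤ t<m))

    inverted : Fin m → Bool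
    inverted k = In k (X k) ∧ (In k (Y k) ∧ (Y k <F X k))

    -- By `parity`, an odd number of earlier crossings means that `X k <F Y k` fails. On distinct
    -- wires this is `Y k <F X k`; on equal wires there is neither a meeting nor an inversion.
    defect-spec : toℕ s < toℕ s′ → ∀ k → defectAt p q k ≡ inverted k
    defect-spec s<s′ k rewrite meet-spec k with bool? (In k (X k) ∧ In k (Y k)) | bool? (X k ==F Y k)
    ... | inj₂ apart | _ rewrite sym (∧-assoc (In k (X k)) (In k (Y k)) (Y k <F X k)) | apart = refl
    ... | inj₁ both | inj₁ eq with ∧-true (In k (X k)) both
    ...   | ix , iy rewrite ix | iy | eq with ==F⇒≡ {i = X k} eq
    ...     | xy rewrite xy = sym (<F-false {i = Y k} (<-irrefl refl))
    defect-spec s<s′ k | inj₁ both | inj₂ neq with ∧-true (In k (X k)) both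
    ... | ix , iy rewrite ix | iy | neq | count-tabulate (λ k′ → (k′ <F k) ∧ crossingAt p q k′) (λ k → k)
      | parity-now (parity s<s′ (toℕ k) (<⇒≤ (toℕ<n k))) (==F⇒≢ neq) = <F-flip {i = X k} {Y k} (==F⇒≢ {i = X k} neq)

  -- Path families as flows

  defective : Fin m → (Fin n → Fin n) → Fin n → Fin n → Bool
  defective k g a b = (a <F b) ∧ (In k (g a) ∧ (In k (g b) ∧ (g b <F g a)))

  defectsAt : Fin m → (Fin n → Fin n) → ℕ
  defectsAt k g = sum λ a → sum λ b → ⟦ defective k g a b ⟧

  defects : (Fin n → Trajectory) → ℕ
  defects R = sum λ k → defectsAt k (λ a → R a (toℕ k))

  -- Paths and covering in terms of single times and steps. `cover` only counts the trajectories on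
  -- a wire at one time, so permuting the trajectories at that time preserves it.
  record Flow (v : Permutation′ n) (R : Fin n → Trajectory) : Set where
    field
      start : ∀ a → T (isEdge (src a) (R a 0))
      step  : ∀ a k → Step k (R a (toℕ k)) (R a (suc (toℕ k)))
      end   : ∀ a → R a m ≡ v ⟨$⟩ʳ a
      cover : ∀ u i → T (isEdge u i) → sum (λ a → ⟦ R a (time u) ==F i ⟧) ≡ mult u i

    origin : ∀ a → R a 0 ≡ a
    origin a = sym (==F⇒≡ {i = a} (edge⇒raw (src a) _ (start a)))

  module _ {v : Permutation′ n} (π : PathFamily v) (R : Fin n → Trajectory)
           (follows : ∀ a → Follows (R a) (src a) (Path.ws (π a))) where

    uses-sum : ∀ u i → T (isEdge u i) →
      count (λ a → usesEdge (π a) u i) (allFin n) ≡ sum (λ a → ⟦ R a (time u) ==F i ⟧)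
    uses-sum u i e = trans (count-tabulate (λ a → usesEdge (π a) u i) (λ a → a))
      (sum-cong-≗ λ a → cong ⟦_⟧ (uses-spec (π a) u i (follows a) e))

    -- Moves the sum over vertices outermost, so that families can be compared vertex by vertex.
    dfct-defects : dfct {v} π ≡ defects R
    dfct-defects = begin
      dfct {v} π
        ≡⟨ ListAction-sum-tabulate {m = n} _ (λ a → a) ⟩
      _
        ≡⟨ sum-cong-≗ (λ a → trans (ListAction-sum-tabulate {m = n} _ (λ b → b)) (sum-cong-≗ (pair a))) ⟩
      (sum λ a → sum λ b → sum λ k → inv a b k)
        ≡⟨ sum-cong-≗ (λ a → ∑-comm (inv a)) ⟩
      (sum λ a → sum λ k → sum λ b → inv a b k)
        ≡⟨ ∑-comm (λ a k → sum λ b → inv a b k) ⟩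
      defects R ∎
      where
      open ≡-Reasoning
      inv : Fin n → Fin n → Fin m → ℕ
      inv a b k = ⟦ defective k (λ a → R a (toℕ k)) a b ⟧
      pair : ∀ a b → count (λ k → (a <F b) ∧ defectAt (π a) (π b) k) (allFin m) ≡ sum (inv a b)
      pair a b = trans (count-tabulate (λ k → (a <F b) ∧ defectAt (π a) (π b) k) (λ k → k)) (sum-cong-≗ λ k → cong ⟦_⟧ (agree k))
        where
        agree : ∀ k → (a <F b) ∧ defectAt (π a) (π b) k ≡ defective k (λ a → R a (toℕ k)) a b
        agree k = ∧-congʳ-if (a <F b) λ lt → Pair.defect-spec (π a) (π b) (follows a) (follows b) (<F⇒< {i = a} lt) k

  toFlow : ∀ {v d} → PiVD v d → ∃ λ R → Flow v R × defects R ≡ d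
  toFlow {v} (π , covers , refl) = R , flow , sym (dfct-defects {v} π R follows)
    where
    trajectory : ∀ a → ∃ λ r → Follows r (src a) (Path.ws (π a)) × r m ≡ v ⟨$⟩ʳ a
    trajectory a = Valid⇒Follows (src a) (Path.ws (π a)) (λ _ ()) (Path.ok (π a))
    R : Fin n → Trajectory
    R a = proj₁ (trajectory a)
    follows : ∀ a → Follows (R a) (src a) (Path.ws (π a))
    follows a = proj₁ (proj₂ (trajectory a))
    flow : Flow v R
    flow = record
      { start = λ a → Follows-edge z≤n (follows a)
      ; step  = λ a k → Follows-step (follows a) k z≤n
      ; end   = λ a → proj₂ (proj₂ (trajectory a))
      ; cover = λ u i e → trans (sym (uses-sum {v} π R follows u i e)) (covers u i e)
      }

  fromFlow : ∀ {v R} → Flow v R → PiVD v (defects R)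
  fromFlow {v} {R} flow = π , covers , dfct-defects {v} π R follows
    where
    open Flow flow
    word : ∀ a → ∃ (Follows (R a) (src a))
    word a = follow (R a) m (src a) (m≤m+n m 0) (start a) (λ k _ → step a k)
    follows : ∀ a → Follows (R a) (src a) (proj₁ (word a))
    follows a = proj₂ (word a)
    π : PathFamily v
    π a = path (proj₁ (word a))
               (subst (λ z → Valid (src a) (proj₁ (word a)) (snk z)) (end a) (Follows⇒Valid z≤n (follows a)))
    covers : Covers {v} π
    covers u i e = trans (uses-sum {v} π R follows u i e) (cover u i e)

  -- Uncrossing a defect

  -- The times are 0 to `m`, hence `suc m`. The weight decreases with the index, so giving the lower
  -- of two wires to the smaller index lowers the sum.
  potential : (Fin n → Trajectory) → ℕ
  potential R = sum {suc m} λ t → sum λ a → (n ∸ toℕ a) * toℕ (R a (toℕ t))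

  record TightDefect (R : Fin n → Trajectory) (k : Fin m) : Set where
    field
      {i j}   : Fin n
      i<j     : toℕ i < toℕ j
      in-i    : In k (R i (toℕ k)) ≡ true
      in-j    : In k (R j (toℕ k)) ≡ true
      above   : toℕ (R j (toℕ k)) < toℕ (R i (toℕ k))
      between : ∀ h → toℕ i < toℕ h → toℕ h < toℕ j → In k (R h (toℕ k)) ≡ true → ⊥

  -- Let `h` pass through `x_k` with index strictly between. If `j` enters below `h`, the pair
  -- `(h , j)` is defective; otherwise `h` enters no higher than `j`, hence below `i`, and `(i , h)`
  -- is. The index gap, bounded by the fuel, shrinks.
  tighten : ∀ R k fuel i j → toℕ j ≤ fuel + toℕ i → toℕ i < toℕ j →
    In k (R i (toℕ k)) ≡ true → In k (R j (toℕ k)) ≡ true →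
    toℕ (R j (toℕ k)) < toℕ (R i (toℕ k)) → TightDefect R k
  tighten R k zero i j j≤i i<j _ _ _ = contradiction i<j (≤⇒≯ j≤i)
  tighten R k (suc fuel) i j j≤ i<j ii ij above
    with any? (λ h → (toℕ i <? toℕ h) ×-dec (toℕ h <? toℕ j) ×-dec (In k (R h (toℕ k)) Bool.≟ true))
  ... | no none = record
    { i<j = i<j ; in-i = ii ; in-j = ij ; above = above
    ; between = λ h i<h h<j ih → none (h , i<h , h<j , ih) }
  ... | yes (h , i<h , h<j , ih) with <-≤-connex (toℕ (R j (toℕ k))) (toℕ (R h (toℕ k)))
  ...   | inj₁ j<h = tighten R k fuel h j j≤′ h<j ih ij j<h
    where
    j≤′ : toℕ j ≤ fuel + toℕ h
    j≤′ = ≤-trans j≤ (≤-trans (≤-reflexive (sym (+-suc fuel (toℕ i)))) (+-monoʳ-≤ fuel i<h))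
  ...   | inj₂ h≤j = tighten R k fuel i h (≤-pred (≤-trans h<j j≤)) i<h ii ih (≤-<-trans h≤j above)

  record FirstDefect (R : Fin n → Trajectory) : Set where
    field
      k      : Fin m
      tight  : TightDefect R k
      before : ∀ k′ → toℕ k′ < toℕ k → defectsAt k′ (λ a → R a (toℕ k′)) ≡ 0

  first-defect : ∀ R → defects R ≢ 0 → FirstDefect R
  first-defect R neq
    with k , at-k , before ← ¬∀⟶∃¬-smallest m (λ k → defectsAt k (λ a → R a (toℕ k)) ≡ 0) (λ k → _ ≟ 0)
           (λ all → neq (trans (sum-cong-≗ all) (sum-replicate-zero m)))
    with i , at-i ← sum≢0 at-k
    with j , at-j ← sum≢0 at-i
    with bool? (defective k (λ a → R a (toℕ k)) i j)
  ... | inj₂ no-defect = contradiction (cong ⟦_⟧ no-defect) at-j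
  ... | inj₁ defect
    with lt , rest ← ∧-true (i <F j) defect
    with ii , rest′ ← ∧-true (In k (R i (toℕ k))) rest
    with ij , above ← ∧-true (In k (R j (toℕ k))) rest′ = record
    { k = k
    ; tight = tighten R k (toℕ j) i j (m≤m+n _ _) (<F⇒< {i = i} lt) ii ij (<F⇒< {i = R j (toℕ k)} above)
    ; before = λ k′ k′<k → subst (λ k → defectsAt k (λ a → R a (toℕ k)) ≡ 0)
        (toℕ-injective (trans (toℕ-inject (fromℕ< k′<k)) (toℕ-fromℕ< k′<k))) (before (fromℕ< k′<k))
    }

  record Meeting (R : Fin n → Trajectory) (i j : Fin n) (t : ℕ) : Set where
    field
      l    : Fin m
      l<t  : toℕ l < t
      both : (In l (R i (toℕ l)) ∧ In l (R j (toℕ l))) ≡ true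
      inverted-since : ∀ u → toℕ l < u → u ≤ t → toℕ (R j u) < toℕ (R i u)

  module _ {v : Permutation′ n} {R : Fin n → Trajectory} (flow : Flow v R) where
    open Flow flow

    -- At time 0 the pair is in order, and by `step-reflects-<` an inversion after a vertex not
    -- visited by both paths was there before it. So going back from `t` reaches a common vertex,
    -- with the inversion present all the way.
    last-meeting : ∀ {i j} → toℕ i < toℕ j → ∀ t → t ≤ m → toℕ (R j t) < toℕ (R i t) → Meeting R i j t
    last-meeting {i} {j} i<j zero _ above rewrite origin i | origin j = contradiction i<j (<⇒≯ above)
    last-meeting {i} {j} i<j (suc t) t<m = subst
      (λ u → (toℕ (R j u) < toℕ (R i u) → Meeting R i j u) →
             toℕ (R j (suc u)) < toℕ (R i (suc u)) → Meeting R i j (suc u))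
      (toℕ-fromℕ< t<m) (extend (fromℕ< t<m)) (last-meeting i<j t (<⇒≤ t<m))
      where
      extend : ∀ l → (toℕ (R j (toℕ l)) < toℕ (R i (toℕ l)) → Meeting R i j (toℕ l)) →
        toℕ (R j (suc (toℕ l))) < toℕ (R i (suc (toℕ l))) → Meeting R i j (suc (toℕ l))
      extend l ih above with bool? (In l (R i (toℕ l)) ∧ In l (R j (toℕ l)))
      ... | inj₁ both = record
        { l = l ; l<t = ≤-refl ; both = both
        ; inverted-since = λ u l<u u≤ → subst (λ u → toℕ (R j u) < toℕ (R i u)) (≤-antisym l<u u≤) above }
      ... | inj₂ apart = record
        { l = earlier.l ; l<t = m≤n⇒m≤1+n earlier.l<t ; both = earlier.both ; inverted-since = since }
        where
        module earlier = Meeting (ih (step-reflects-< (step j l) (step i l)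
          (trans (∧-comm (In l (R j (toℕ l))) _) apart) above))
        since : ∀ u → toℕ earlier.l < u → u ≤ suc (toℕ l) → toℕ (R j u) < toℕ (R i u)
        since u l<u u≤ with m≤n⇒m<n∨m≡n u≤
        ... | inj₁ (s≤s u≤l) = earlier.inverted-since u l<u u≤l
        ... | inj₂ refl = above

    module Uncross (first : FirstDefect R) where
      open FirstDefect first
      open TightDefect tight
      open Meeting (last-meeting i<j (toℕ k) (<⇒≤ (toℕ<n k)) above)
      open Transposition i j

      -- Edges leaving `x_l` are shown at `suc (toℕ l)` and edges entering `x_k` at `toℕ k`, hence
      -- strict on the left and weak on the right.
      inside? : ∀ t → Dec (toℕ l < t × t ≤ toℕ k)
      inside? t = (toℕ l <? t) ×-dec (t ≤? toℕ k)

      σ : ℕ → Permutation′ n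
      σ t with inside? t
      ... | yes _ = transpose i j
      ... | no  _ = idₚ

      R′ : Fin n → Trajectory
      R′ a t = R (σ t ⟨$⟩ʳ a) t

      change : ∀ {q b c} → In q (R b (toℕ q)) ≡ true → In q (R c (toℕ q)) ≡ true →
        Step q (R b (toℕ q)) (R c (suc (toℕ q)))
      change {q} {c = c} ib ic = (λ _ → proj₁ (step c q) ic) , (λ nb → true≢false ib nb)

      switch-step : ∀ q → In q (R i (toℕ q)) ≡ true → In q (R j (toℕ q)) ≡ true → ∀ a →
        Step q (R a (toℕ q)) (R (τ a) (suc (toℕ q))) × Step q (R (τ a) (toℕ q)) (R a (suc (toℕ q)))
      switch-step q ii ij a with τ a | view a
      ... | _ | at-i refl = change {b = i} {j} ii ij , change {b = j} {i} ij ii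
      ... | _ | at-j refl = change {b = j} {i} ij ii , change {b = i} {j} ii ij
      ... | _ | fixed _ _ = step a q , step a q

      step′ : ∀ a q → Step q (R′ a (toℕ q)) (R′ a (suc (toℕ q)))
      step′ a q with inside? (toℕ q) | inside? (suc (toℕ q))
      ... | yes _ | yes _ = step (τ a) q
      ... | no _  | no _  = step a q
      -- The exchange ends here, so `q` is `k`, where both paths pass.
      ... | yes (l<q , q≤k) | no out
        with refl ← toℕ-injective (≤-antisym q≤k (≮⇒≥ λ q<k → out (m≤n⇒m≤1+n l<q , q<k))) =
        proj₂ (switch-step k in-i in-j a)
      -- The exchange begins here, so `q` is `l`.
      ... | no out | yes (s≤s l≤q , q<k)
        with refl ← toℕ-injective {i = l} (≤-antisym l≤q (≮⇒≥ λ l<q → out (l<q , <⇒≤ q<k))) =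
        proj₁ (switch-step l (proj₁ (∧-true (In l (R i (toℕ l))) both)) (proj₂ (∧-true (In l (R i (toℕ l))) both)) a)

      flow′ : Flow v R′
      flow′ = record { start = start′ ; step = step′ ; end = end′ ; cover = cover′ }
        where
        -- Time 0 is not after `l` and time `m` is after `k`, so sources and sinks are unaffected.
        start′ : ∀ a → T (isEdge (src a) (R′ a 0))
        start′ a with inside? 0
        ... | no _ = start a
        end′ : ∀ a → R′ a m ≡ v ⟨$⟩ʳ a
        end′ a with inside? m
        ... | yes (_ , m≤k) = contradiction (toℕ<n k) (≤⇒≯ m≤k)
        ... | no _ = end a
        cover′ : ∀ u i → T (isEdge u i) → sum (λ a → ⟦ R′ a (time u) ==F i ⟧) ≡ mult u i
        cover′ u i e = trans (sym (sum-permute (λ a → ⟦ R a (time u) ==F i ⟧) (σ (time u)))) (cover u i e)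

      potential-decreases : potential R′ < potential R
      potential-decreases = sum-mono-< {f = f R′} {f R} weak (fromℕ< k<) strict
        where
        f : (Fin n → Trajectory) → Fin (suc m) → ℕ
        f R t = sum λ a → (n ∸ toℕ a) * toℕ (R a (toℕ t))
        k< : toℕ k < suc m
        k< = m≤n⇒m≤1+n (toℕ<n k)
        inside-< : ∀ t → toℕ l < t → t ≤ toℕ k →
          sum (λ a → (n ∸ toℕ a) * toℕ (R (τ a) t)) < sum (λ a → (n ∸ toℕ a) * toℕ (R a t))
        inside-< t l<t t≤k = weighted-sum-transpose (λ a → n ∸ toℕ a) (λ a → toℕ (R a t))
          (∸-monoʳ-< i<j (<⇒≤ (toℕ<n j))) (inverted-since t l<t t≤k)
        weak : ∀ t → f R′ t ≤ f R t
        weak t with inside? (toℕ t)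
        ... | yes (l<t , t≤k) = <⇒≤ (inside-< (toℕ t) l<t t≤k)
        ... | no _ = ≤-refl
        strict : f R′ (fromℕ< k<) < f R (fromℕ< k<)
        strict rewrite toℕ-fromℕ< k< with inside? (toℕ k)
        ... | yes (l<t , t≤k) = inside-< (toℕ k) l<t t≤k
        ... | no out = contradiction (l<t , ≤-refl) out

      inverted-pair : Fin n → Fin n → Bool
      inverted-pair a b = In k (R a (toℕ k)) ∧ (In k (R b (toℕ k)) ∧ (R b (toℕ k) <F R a (toℕ k)))

      -- No other path through x_k has its index between i and j, so the
      -- transposition preserves the order of every other inverted pair.
      keeps-order : ∀ a b → toℕ a < toℕ b → inverted-pair a b ≡ true →
        (toℕ (τ a) < toℕ (τ b)) ⊎ (a ≡ i × b ≡ j)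
      keeps-order a b a<b inv with ∧-true (In k (R a (toℕ k))) inv
      ... | ia , rest with ∧-true (In k (R b (toℕ k))) rest
      ...   | ib , _ with τ a | view a | τ b | view b
      ... | _ | at-i refl | _ | at-i refl = contradiction a<b (<-irrefl refl)
      ... | _ | at-i refl | _ | at-j refl = inj₂ (refl , refl)
      ... | _ | at-i refl | _ | fixed _ b≢j with <-cmp (toℕ b) (toℕ j)
      ...   | tri< b<j _ _ = ⊥-elim (between b a<b b<j ib)
      ...   | tri≈ _ eq _ = contradiction (toℕ-injective eq) b≢j
      ...   | tri> _ _ j<b = inj₁ j<b
      keeps-order a b a<b inv | ia , _ | ib , _ | _ | at-j refl | _ | at-i refl = contradiction i<j (<⇒≯ a<b)
      keeps-order a b a<b inv | ia , _ | ib , _ | _ | at-j refl | _ | at-j refl = contradiction a<b (<-irrefl refl)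
      keeps-order a b a<b inv | ia , _ | ib , _ | _ | at-j refl | _ | fixed _ _ = inj₁ (<-trans i<j a<b)
      keeps-order a b a<b inv | ia , _ | ib , _ | _ | fixed _ _ | _ | at-i refl = inj₁ (<-trans a<b i<j)
      keeps-order a b a<b inv | ia , _ | ib , _ | _ | fixed a≢i _ | _ | at-j refl with <-cmp (toℕ a) (toℕ i)
      ...   | tri< a<i _ _ = inj₁ a<i
      ...   | tri≈ _ eq _ = contradiction (toℕ-injective eq) a≢i
      ...   | tri> _ _ i<a = ⊥-elim (between a i<a a<b ia)
      keeps-order a b a<b inv | ia , _ | ib , _ | _ | fixed _ _ | _ | fixed _ _ = inj₁ a<b

      -- Outside the exchange nothing changes. Between `x_l` and `x_k` the left side is 0 by the
      -- choice of `k`. At `x_k` itself `inversions-transpose` bounds the loss by one.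
      defectsAt-≤ : ∀ q → defectsAt q (λ a → R a (toℕ q)) ≤ defectsAt q (λ a → R′ a (toℕ q)) + ⟦ q ==F k ⟧
      defectsAt-≤ q with inside? (toℕ q)
      ... | no _ = m≤m+n _ _
      ... | yes (_ , q≤k) with m≤n⇒m<n∨m≡n q≤k
      ...   | inj₁ q<k rewrite before q q<k = z≤n
      ...   | inj₂ q≡k with refl ← toℕ-injective q≡k rewrite ==F-true {i = k} refl =
        ≤-trans (inversions-transpose inverted-pair keeps-order) (≤-reflexive (+-comm 1 _))

      defects-≤ : defects R ≤ suc (defects R′)
      defects-≤ = begin
        defects R
          ≤⟨ sum-mono-≤ defectsAt-≤ ⟩
        (sum λ q → defectsAt q (λ a → R′ a (toℕ q)) + ⟦ q ==F k ⟧)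
          ≡⟨ ∑-distrib-+ (λ q → defectsAt q (λ a → R′ a (toℕ q))) (λ q → ⟦ q ==F k ⟧) ⟩
        defects R′ + sum (λ q → ⟦ q ==F k ⟧)
          ≡⟨ cong (defects R′ +_) (sum-δ k) ⟩
        defects R′ + 1
          ≡⟨ +-comm (defects R′) 1 ⟩
        suc (defects R′) ∎
        where open ≤-Reasoning

  -- The exchange may create defects, so the recursion is on the potential. As long as `e` is less
  -- than the number of defects, `defects-≤` keeps it at most the next number, so the descent stops
  -- only at equality.
  reach : ∀ {v e} R → Acc _<_ (potential R) → Flow v R → e ≤ defects R → ∃ λ R′ → Flow v R′ × defects R′ ≡ e
  reach {v} R (acc smaller) flow e≤ with m≤n⇒m<n∨m≡n e≤
  ... | inj₂ refl = R , flow , refl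
  ... | inj₁ e<  = reach R′ (smaller potential-decreases) flow′ (≤-pred (≤-trans e< defects-≤))
    where open Uncross {v} flow (first-defect R (m<n⇒n≢0 e<))

theorem4p9 : {n m : ℕ} (I : Fin m → Interval n) (S : Shape m)
    (v : Permutation′ n) (d : ℕ) → 1 ≤ d →
    Net.PiVD I S v d →
    (e : ℕ) → e < d → Net.PiVD I S v e
theorem4p9 I S v d _ πs e e<d
  with R , flow , refl ← Trajectories.toFlow I S {v} πs
  with R′ , flow′ , refl ← Trajectories.reach I S {v} R (<-wellFounded _) flow (<⇒≤ e<d)
  = Trajectories.fromFlow I S {v} flow′
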